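{- Let $0<q<1$ and let $E_{n,q}(x)$, $E_{n,q}$ and $E^{(r)}_{k,q}(x)$ be as defined in the context. Then for all integers $n,r \geq 0$, $$E_{n,q}(x)=\frac{1}{2^r}\sum_{k=0}^{n} \Bigg\{ \sum_{m=0}^{n-k}\sum_{l=0}^{r} \sum_{\substack{i_1+ \cdots +i_l=m\\ i_1,\dots,i_l\ge0}}\binom{r}{l}\binom{m}{i_1, \cdots , i_l}_q \binom{m+k}{m}_q \binom{n}{m+k}_q E_{n-m-k,q} \Bigg\} E_{k,q}^{(r)}(x),$$ where $\binom{m}{i_1, \cdots , i_l}_q=\frac{[m]_q!}{[i_1]_q!\cdots[i_l]_q!}$.
   Context: Fix a real number $q$ with $0<q<1$. For an integer $n\ge 0$ set $[n]_q=\frac{1-q^n}{1-q}$, $[0]_q!=1$, $[n]_q!=[1]_q\cdots[n]_q$, and $\binom{n}{k}_q=\frac{[n]_q!}{[k]_q![n-k]_q!}$ for $0\le k\le n$. Let $e_q(z)=\sum_{n=0}^{\infty}\frac{z^n}{[n]_q!}$. The $q$-Euler polynomials are defined by $\frac{2}{e_q(t)+1}e_q(xt)=\sum_{n\ge0}E_{n,q}(x)\frac{t^n}{[n]_q!}$, with $E_{n,q}=E_{n,q}(0)$. For an integer $r\ge0$, the $q$-Euler polynomials of order $r$ are defined by $\left(\frac{2}{e_q(t)+1}\right)^r e_q(xt)=\sum_{n\ge0}E^{(r)}_{n,q}(x)\frac{t^n}{[n]_q!}$. For $l=0$ the sum over $i_1+\cdots+i_0=m$ is understood as $1$ if $m=0$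 and $0$ otherwise. -}

module Defs where

open import Level using (Level)
open import Algebra.Bundles using (CommutativeRing)
open import Data.Nat using (ℕ; zero; suc; _∸_; _≟_)
open import Data.Nat.Combinatorics using (_C_)
open import Data.Vec using (Vec; []; _∷_; head; lookup)
open import Data.Fin using (Fin; toℕ)
open import Relation.Nullary using (yes; no)

-- All q-objects of the paper, over a commutative ring R.  For the paper's
-- setting take R = ℝ, with 0 < q < 1; the inverses that the paper's
-- fractions require are passed in explicitly:
--   i1q : inverse of (1 - q)            (used in [n]_q = (1 - q^n)/(1 - q))
--   i2  : inverse of 2 = 1 + 1
--   iq n : inverse of [suc n]_q
module QEuler {c ℓ : Level} (R : CommutativeRing c ℓ)
              (q i1q i2 : CommutativeRing.Carrier R) (iq : ℕ → CommutativeRing.Carrier R) where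
  open CommutativeRing R

  pow : Carrier → ℕ → Carrier
  pow a zero = 1#
  pow a (suc n) = pow a n * a

  fromℕ : ℕ → Carrier
  fromℕ zero = 0#
  fromℕ (suc n) = 1# + fromℕ n

  sumTo : ℕ → (ℕ → Carrier) → Carrier
  sumTo zero f = 0#
  sumTo (suc n) f = sumTo n f + f n

  qint : ℕ → Carrier
  qint n = (1# - pow q n) * i1q

  qfact : ℕ → Carrier
  qfact zero = 1#
  qfact (suc n) = qfact n * qint (suc n)

  qfactInv : ℕ → Carrier
  qfactInv zero = 1#
  qfactInv (suc n) = qfactInv n * iq n

  qbinom : ℕ → ℕ → Carrier
  qbinom n k = qfact n * (qfactInv k * qfactInv (n ∸ k))

  prodFactInv : {l : ℕ} → Vec ℕ l → Carrier
  prodFactInv [] = 1#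
  prodFactInv (i ∷ is) = qfactInv i * prodFactInv is

  qmultinom : {l : ℕ} → ℕ → Vec ℕ l → Carrier
  qmultinom m is = qfact m * prodFactInv is

  compSum : (l : ℕ) → ℕ → (Vec ℕ l → Carrier) → Carrier
  compSum zero m f with m ≟ 0
  ... | yes _ = f []
  ... | no _ = 0#
  compSum (suc l) m f = sumTo (suc m) (λ i → compSum l (m ∸ i) (λ is → f (i ∷ is)))

  -- formal power series in t: coefficient sequences
  PS : Set c
  PS = ℕ → Carrier

  _⋆_ : PS → PS → PS
  (a ⋆ b) n = sumTo (suc n) (λ k → a k * b (n ∸ k))

  constPS : Carrier → PS
  constPS a zero = a
  constPS a (suc n) = 0#

  _⊕_ : PS → PS → PS
  (a ⊕ b) n = a n + b n

  powPS : PS → ℕ → PS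
  powPS a zero = constPS 1#
  powPS a (suc r) = powPS a r ⋆ a

  -- multiplicative inverse of a power series c, given an inverse i0 of c 0:
  -- b 0 = i0,  b n = - i0 * Σ_{k=1}^{n} c k * b (n - k)
  -- invVec c i0 n = (b n , b (n-1) , … , b 0)
  invVec : PS → Carrier → (n : ℕ) → Vec Carrier (suc n)
  invVec c i0 zero = i0 ∷ []
  invVec c i0 (suc n) =
    (- (i0 * sumTo (suc n) (λ j → c (suc j) * lookAt j bs))) ∷ bs
    where
      bs = invVec c i0 n
      lookAt : ℕ → Vec Carrier (suc n) → Carrier
      lookAt j v = lookupℕ j v
        where
          lookupℕ : {k : ℕ} → ℕ → Vec Carrier k → Carrier
          lookupℕ _ [] = 0#
          lookupℕ zero (x ∷ _) = x
          lookupℕ (suc j) (_ ∷ xs) = lookupℕ j xs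

  invPS : PS → Carrier → PS
  invPS c i0 n = head (invVec c i0 n)

  eq : PS
  eq n = qfactInv n

  eqx : Carrier → PS
  eqx x n = pow x n * qfactInv n

  -- 2 / (e_q(t) + 1)   (constant term of e_q(t) + 1 is 1 + 1, inverse i2)
  twoOver : PS
  twoOver n = (1# + 1#) * invPS (eq ⊕ constPS 1#) i2 n

  Eq : ℕ → Carrier → Carrier
  Eq n x = qfact n * (twoOver ⋆ eqx x) n

  Eq0 : ℕ → Carrier
  Eq0 n = Eq n 0#

  Eqr : ℕ → ℕ → Carrier → Carrier
  Eqr r n x = qfact n * (powPS twoOver r ⋆ eqx x) n

  rhs8 : ℕ → ℕ → Carrier → Carrier
  rhs8 n r x =
    pow i2 r *
    sumTo (suc n) (λ k →
      sumTo (suc (n ∸ k)) (λ m →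
        sumTo (suc r) (λ l →
          compSum l m (λ is →
            fromℕ (r C l) * qmultinom m is * qbinom (m Data.Nat.+ k) m
              * qbinom n (m Data.Nat.+ k) * Eq0 (n ∸ m ∸ k))))
      * Eqr r k x)

{-# OPTIONS --safe #-}
module Submission where

-- Let G(t) = 2 / (e_q(t) + 1).  Since (e_q + 1) G = 2, we have
--   2^r G(t) e_q(xt) = (e_q(t) + 1)^r G(t) · G(t)^r e_q(xt).
-- Expanding (e_q + 1)^r = Σ_l (r C l) e_q^l, whose m-th coefficient is a sum of
-- q-multinomials over compositions of m, and comparing coefficients of t^n
-- gives the identity.

open import Defs
open import Level using (Level)
open import Algebra.Bundles using (CommutativeRing; CommutativeMonoid)
open import Data.Nat using (ℕ; zero; suc; _∸_; _≤_; _<_; z≤n; s≤s)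
import Data.Nat as ℕ
import Data.Nat.Properties as ℕₚ
open import Data.Nat.Combinatorics
  using (_C_; nCn≡1; nCk≡nC[n∸k]; k>n⇒nCk≡0; nCk+nC[k+1]≡[n+1]C[k+1])
open import Data.Product using (_,_)
open import Data.Vec using (Vec; []; _∷_)
open import Relation.Binary.PropositionalEquality as ≡ using (_≡_)
import Algebra.Properties.CommutativeSemigroup
import Algebra.Properties.Ring
import Algebra.Solver.CommutativeMonoid
import Relation.Binary.Reasoning.Setoid

module PowerSeries {c ℓ : Level} (R : CommutativeRing c ℓ)
                   (q i1q i2 : CommutativeRing.Carrier R)
                   (iq : ℕ → CommutativeRing.Carrier R) where
  open CommutativeRing R
  open QEuler R q i1q i2 iq
  open Relation.Binary.Reasoning.Setoid setoid
  private
    module +-Semigroup = Algebra.Properties.CommutativeSemigroup +-commutativeSemigroup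
    module *-Semigroup = Algebra.Properties.CommutativeSemigroup *-commutativeSemigroup

  -- Finite sums.

  -- The bound `i < n` is passed on because identities of truncated subtraction such as
  -- `n ∸ (n ∸ i) ≡ i` hold only within the range of summation.
  sumTo-cong : ∀ n {f g} → (∀ i → i < n → f i ≈ g i) → sumTo n f ≈ sumTo n g
  sumTo-cong zero    f≈g = refl
  sumTo-cong (suc n) f≈g =
    +-cong (sumTo-cong n λ i i<n → f≈g i (ℕₚ.m<n⇒m<1+n i<n)) (f≈g n ℕₚ.≤-refl)

  sumTo-0 : ∀ n {f} → (∀ i → f i ≈ 0#) → sumTo n f ≈ 0#
  sumTo-0 zero    f≈0 = refl
  sumTo-0 (suc n) f≈0 = trans (+-cong (sumTo-0 n f≈0) (f≈0 n)) (+-identityˡ 0#)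

  sumTo-+ : ∀ n f g → sumTo n (λ i → f i + g i) ≈ sumTo n f + sumTo n g
  sumTo-+ zero    f g = sym (+-identityˡ 0#)
  sumTo-+ (suc n) f g = begin
    sumTo n (λ i → f i + g i) + (f n + g n)  ≈⟨ +-congʳ (sumTo-+ n f g) ⟩
    (sumTo n f + sumTo n g) + (f n + g n)    ≈⟨ +-Semigroup.interchange _ _ _ _ ⟩
    (sumTo n f + f n) + (sumTo n g + g n)    ∎

  *-sumTo : ∀ a n f → a * sumTo n f ≈ sumTo n (λ i → a * f i)
  *-sumTo a zero    f = zeroʳ a
  *-sumTo a (suc n) f = trans (distribˡ a _ _) (+-congʳ (*-sumTo a n f))

  sumTo-* : ∀ a n f → sumTo n f * a ≈ sumTo n (λ i → f i * a)
  sumTo-* a zero    f = zeroˡ a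
  sumTo-* a (suc n) f = trans (distribʳ a _ _) (+-congʳ (sumTo-* a n f))

  sumTo-swap : ∀ m n (f : ℕ → ℕ → Carrier) →
    sumTo m (λ i → sumTo n (f i)) ≈ sumTo n (λ j → sumTo m (λ i → f i j))
  sumTo-swap zero    n f = sym (sumTo-0 n λ _ → refl)
  sumTo-swap (suc m) n f = trans (+-congʳ (sumTo-swap m n f)) (sym (sumTo-+ n _ _))

  sumTo-suc : ∀ n f → sumTo (suc n) f ≈ f 0 + sumTo n (λ i → f (suc i))
  sumTo-suc zero    f = +-comm 0# (f 0)
  sumTo-suc (suc n) f = trans (+-congʳ (sumTo-suc n f)) (+-assoc _ _ _)

  sumTo-reverse : ∀ n f → sumTo (suc n) f ≈ sumTo (suc n) (λ i → f (n ∸ i))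
  sumTo-reverse zero    f = refl
  sumTo-reverse (suc n) f = begin
    sumTo (suc (suc n)) f
      ≈⟨ sumTo-suc (suc n) f ⟩
    f 0 + sumTo (suc n) (λ i → f (suc i))
      ≈⟨ +-congˡ (sumTo-reverse n _) ⟩
    f 0 + sumTo (suc n) (λ i → f (suc (n ∸ i)))
      ≈⟨ +-comm _ _ ⟩
    sumTo (suc n) (λ i → f (suc (n ∸ i))) + f 0
      ≈⟨ +-cong
           (sumTo-cong (suc n) λ i i≤n →
             reflexive (≡.cong f (≡.sym (ℕₚ.+-∸-assoc 1 (ℕₚ.≤-pred i≤n)))))
           (reflexive (≡.cong f (≡.sym (ℕₚ.n∸n≡0 n)))) ⟩
    sumTo (suc (suc n)) (λ i → f (suc n ∸ i))
      ∎

  -- Both sides run over the pairs `(j , i)` with `j + i ≤ n`, by antidiagonals on the left and by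
  -- rows on the right. The induction adds one antidiagonal. This is the reindexing behind
  -- `⋆-assoc`.
  sumTo-triangle : ∀ n (f : ℕ → ℕ → Carrier) →
    sumTo (suc n) (λ k → sumTo (suc k) (λ j → f j (k ∸ j))) ≈
    sumTo (suc n) (λ j → sumTo (suc (n ∸ j)) (f j))
  sumTo-triangle zero    f = refl
  sumTo-triangle (suc n) f = begin
    sumTo (suc n) (λ k → sumTo (suc k) (λ j → f j (k ∸ j)))
      + (sumTo (suc n) (λ j → f j (suc n ∸ j)) + f (suc n) (n ∸ n))
      ≈⟨ +-congʳ (sumTo-triangle n f) ⟩
    sumTo (suc n) (λ j → sumTo (suc (n ∸ j)) (f j))
      + (sumTo (suc n) (λ j → f j (suc n ∸ j)) + f (suc n) (n ∸ n))
      ≈⟨ +-assoc _ _ _ ⟨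
    (sumTo (suc n) (λ j → sumTo (suc (n ∸ j)) (f j))
      + sumTo (suc n) (λ j → f j (suc n ∸ j))) + f (suc n) (n ∸ n)
      ≈⟨ +-congʳ (sumTo-+ (suc n) _ _) ⟨
    sumTo (suc n) (λ j → sumTo (suc (n ∸ j)) (f j) + f j (suc n ∸ j)) + f (suc n) (n ∸ n)
      -- The new antidiagonal lengthens each old row by one entry; its last entry alone forms the
      -- new row `suc n`.
      ≈⟨ +-cong (sumTo-cong (suc n) row) corner ⟩
    sumTo (suc (suc n)) (λ j → sumTo (suc (suc n ∸ j)) (f j))
      ∎
    where
    row : ∀ j → j < suc n →
      sumTo (suc (n ∸ j)) (f j) + f j (suc n ∸ j) ≈ sumTo (suc (suc n ∸ j)) (f j)
    row j (s≤s j≤n) rewrite ℕₚ.+-∸-assoc 1 j≤n = refl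
    corner : f (suc n) (n ∸ n) ≈ sumTo (suc (n ∸ n)) (f (suc n))
    corner rewrite ℕₚ.n∸n≡0 n = sym (+-identityˡ _)

  -- Power series under the Cauchy product.

  infix 4 _≋_
  _≋_ : PS → PS → Set ℓ
  a ≋ b = ∀ n → a n ≈ b n

  ⋆-cong : ∀ {a a′ b b′} → a ≋ a′ → b ≋ b′ → (a ⋆ b) ≋ (a′ ⋆ b′)
  ⋆-cong a≋a′ b≋b′ n = sumTo-cong (suc n) λ k _ → *-cong (a≋a′ k) (b≋b′ (n ∸ k))

  ⋆-comm : ∀ a b → (a ⋆ b) ≋ (b ⋆ a)
  ⋆-comm a b n = begin
    sumTo (suc n) (λ k → a k * b (n ∸ k))
      ≈⟨ sumTo-reverse n _ ⟩
    sumTo (suc n) (λ k → a (n ∸ k) * b (n ∸ (n ∸ k)))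
      ≈⟨ sumTo-cong (suc n) (λ k k≤n → trans (*-comm _ _)
           (*-congʳ (reflexive (≡.cong b (ℕₚ.m∸[m∸n]≡n (ℕₚ.≤-pred k≤n)))))) ⟩
    sumTo (suc n) (λ k → b k * a (n ∸ k))
      ∎

  ⋆-assoc : ∀ a b c → ((a ⋆ b) ⋆ c) ≋ (a ⋆ (b ⋆ c))
  ⋆-assoc a b c n = begin
    sumTo (suc n) (λ k → sumTo (suc k) (λ j → a j * b (k ∸ j)) * c (n ∸ k))
      ≈⟨ sumTo-cong (suc n) (λ k _ → trans (sumTo-* _ (suc k) _)
           -- Writing `k` as `j + (k ∸ j)` makes the summand a function of `j` and `k ∸ j`, the
           -- shape required by `sumTo-triangle`.
           (sumTo-cong (suc k) λ j j≤k →
             *-congˡ (reflexive (≡.cong (λ i → c (n ∸ i))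
               (≡.sym (ℕₚ.m+[n∸m]≡n (ℕₚ.≤-pred j≤k))))))) ⟩
    sumTo (suc n) (λ k → sumTo (suc k) (λ j → (a j * b (k ∸ j)) * c (n ∸ (j ℕ.+ (k ∸ j)))))
      ≈⟨ sumTo-triangle n (λ j i → (a j * b i) * c (n ∸ (j ℕ.+ i))) ⟩
    sumTo (suc n) (λ j → sumTo (suc (n ∸ j)) (λ i → (a j * b i) * c (n ∸ (j ℕ.+ i))))
      ≈⟨ sumTo-cong (suc n) (λ j _ → trans
           (sumTo-cong (suc (n ∸ j)) λ i _ → trans (*-assoc _ _ _)
             (*-congˡ (*-congˡ (reflexive (≡.cong c (≡.sym (ℕₚ.∸-+-assoc n j i)))))))
           (sym (*-sumTo (a j) (suc (n ∸ j)) _))) ⟩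
    sumTo (suc n) (λ j → a j * sumTo (suc (n ∸ j)) (λ i → b i * c (n ∸ j ∸ i)))
      ∎

  constPS-⋆ : ∀ a b n → (constPS a ⋆ b) n ≈ a * b n
  constPS-⋆ a b n = begin
    (constPS a ⋆ b) n
      ≈⟨ sumTo-suc n _ ⟩
    a * b n + sumTo n (λ i → 0# * b (n ∸ suc i))
      ≈⟨ +-congˡ (sumTo-0 n λ i → zeroˡ _) ⟩
    a * b n + 0#
      ≈⟨ +-identityʳ _ ⟩
    a * b n
      ∎

  ⋆-identityˡ : ∀ a → (constPS 1# ⋆ a) ≋ a
  ⋆-identityˡ a n = trans (constPS-⋆ 1# a n) (*-identityˡ (a n))

  -- Packaged so that products of series can be regrouped by the generic `interchange` law instead
  -- of by manipulating sums.
  ⋆-commutativeMonoid : CommutativeMonoid c ℓ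
  ⋆-commutativeMonoid = record
    { Carrier = PS
    ; _≈_ = _≋_
    ; _∙_ = _⋆_
    ; ε = constPS 1#
    ; isCommutativeMonoid = record
      { isMonoid = record
        { isSemigroup = record
          { isMagma = record
            { isEquivalence = record
              { refl = λ _ → refl
              ; sym = λ a≋b n → sym (a≋b n)
              ; trans = λ a≋b b≋c n → trans (a≋b n) (b≋c n)
              }
            ; ∙-cong = λ {a} {a′} {b} {b′} → ⋆-cong {a} {a′} {b} {b′}
            }
          ; assoc = ⋆-assoc
          }
        ; identity = ⋆-identityˡ , λ a n → trans (⋆-comm a _ n) (⋆-identityˡ a n)
        }
      ; comm = ⋆-comm
      }
    }

  ⋆-distribʳ-⊕ : ∀ a b d → ((a ⊕ b) ⋆ d) ≋ ((a ⋆ d) ⊕ (b ⋆ d))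
  ⋆-distribʳ-⊕ a b d n =
    trans (sumTo-cong (suc n) λ k _ → distribʳ _ _ _) (sumTo-+ (suc n) _ _)

  private
    module ⋆ = CommutativeMonoid ⋆-commutativeMonoid
    module ⋆-Semigroup = Algebra.Properties.CommutativeSemigroup ⋆.commutativeSemigroup
    module ⋆-Reasoning = Relation.Binary.Reasoning.Setoid ⋆.setoid

  -- Multiplicative inverses of power series.

  infix 8 _‼_
  -- Positions out of range read as `0#`, the same default as in the lookup inside `invVec`, so that
  -- the two agree at every index.
  _‼_ : ∀ {n} → Vec Carrier n → ℕ → Carrier
  []       ‼ _     = 0#
  (x ∷ _)  ‼ zero  = x
  (_ ∷ xs) ‼ suc j = xs ‼ j

  -- The vector stores the newest coefficient first, so passing to its tail lowers the position and
  -- the top index together.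
  invVec-‼ : ∀ a i n j → j ≤ n → invVec a i n ‼ j ≡ invPS a i (n ∸ j)
  invVec-‼ a i zero    zero    z≤n       = ≡.refl
  invVec-‼ a i (suc n) zero    z≤n       = ≡.refl
  invVec-‼ a i (suc n) (suc j) (s≤s j≤n) = invVec-‼ a i n j j≤n

  -- The lookup used by invVec is local to a where block and cannot be named, so
  -- the left-hand sides `_` are left to unification with their use sites; the
  -- with-abstractions make the arguments there distinct variables, so that the
  -- unification problem is a pattern problem.
  mutual
    invPS-suc : ∀ a i n →
      invPS a i (suc n) ≈ - (i * sumTo (suc n) (λ j → a (suc j) * invPS a i (n ∸ j)))
    invPS-suc a i n = -‿cong (*-congˡ (sumTo-cong (suc n) λ j j≤n →
      *-congˡ (reflexive (lookAt-invVec a i n j (ℕₚ.≤-pred j≤n)))))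

    lookAt-invVec : ∀ a i n j → j ≤ n → _ ≡ invPS a i (n ∸ j)
    lookAt-invVec a i n j j≤n with invVec a i n | invVec-‼ a i n j j≤n
    ... | v | v‼j≡b = ≡.trans (lookAt≡‼ a i n j v) v‼j≡b

    lookAt≡‼ : ∀ a i n j (v : Vec Carrier (suc n)) → _ ≡ v ‼ j
    lookAt≡‼ a i n       zero          (x ∷ xs)     = ≡.refl
    lookAt≡‼ a i zero    (suc j)       (x ∷ [])     = ≡.refl
    lookAt≡‼ a i (suc n) (suc zero)    (x ∷ y ∷ ys) = ≡.refl
    lookAt≡‼ a i (suc n) (suc (suc j)) (x ∷ y ∷ ys)
      with suc n | suc (suc j) | x ∷ y ∷ ys
    ... | N | J | v = lookupℕ≡‼ a i N J v j ys

    lookupℕ≡‼ : ∀ a i N J (v : Vec Carrier (suc N)) {n} j (ys : Vec Carrier n) → _ ≡ ys ‼ j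
    lookupℕ≡‼ a i N J v j       []       = ≡.refl
    lookupℕ≡‼ a i N J v zero    (y ∷ ys) = ≡.refl
    lookupℕ≡‼ a i N J v (suc j) (y ∷ ys) = lookupℕ≡‼ a i N J v j ys

  -- The recursion for `invPS` is chosen so that each higher coefficient of the product vanishes: as
  -- `a 0 * i ≈ 1#`, the leading term is minus the sum `S` of the others.
  ⋆-invPS : ∀ a i → a 0 * i ≈ 1# → (a ⋆ invPS a i) ≋ constPS 1#
  ⋆-invPS a i a₀i≈1 zero    = trans (+-identityˡ _) a₀i≈1
  ⋆-invPS a i a₀i≈1 (suc n) = begin
    (a ⋆ invPS a i) (suc n)
      ≈⟨ sumTo-suc (suc n) _ ⟩
    a 0 * invPS a i (suc n) + S
      ≈⟨ +-congʳ (*-congˡ (invPS-suc a i n)) ⟩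
    a 0 * - (i * S) + S
      ≈⟨ +-congʳ (-‿distribʳ-* (a 0) (i * S)) ⟨
    - (a 0 * (i * S)) + S
      ≈⟨ +-congʳ (-‿cong (trans (sym (*-assoc _ _ _))
           (trans (*-congʳ a₀i≈1) (*-identityˡ S)))) ⟩
    - S + S
      ≈⟨ -‿inverseˡ S ⟩
    0#
      ∎
    where
    open Algebra.Properties.Ring ring using (-‿distribʳ-*)
    S = sumTo (suc n) (λ j → a (suc j) * invPS a i (n ∸ j))

  -- Powers and binomial sums.

  pow-* : ∀ a b → a * b ≈ 1# → ∀ r → pow a r * pow b r ≈ 1#
  pow-* a b ab≈1 zero    = *-identityˡ 1#
  pow-* a b ab≈1 (suc r) = begin
    (pow a r * a) * (pow b r * b)  ≈⟨ *-Semigroup.interchange _ _ _ _ ⟩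
    (pow a r * pow b r) * (a * b)  ≈⟨ *-cong (pow-* a b ab≈1 r) ab≈1 ⟩
    1# * 1#                        ≈⟨ *-identityˡ 1# ⟩
    1#                             ∎

  fromℕ-+ : ∀ m n → fromℕ (m ℕ.+ n) ≈ fromℕ m + fromℕ n
  fromℕ-+ zero    n = sym (+-identityˡ _)
  fromℕ-+ (suc m) n = trans (+-congˡ (fromℕ-+ m n)) (sym (+-assoc _ _ _))

  nC0≡1 : ∀ n → n C 0 ≡ 1
  nC0≡1 n = ≡.trans (nCk≡nC[n∸k] {0} {n} z≤n) (nCn≡1 n)

  -- The image of `(1 + z)^r` under the linear map `z^l ↦ p l`. Leaving `p` arbitrary lets the
  -- binomial theorem be applied to one coefficient of a series at a time.
  binomialSum : ℕ → (ℕ → Carrier) → Carrier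
  binomialSum r p = sumTo (suc r) (λ l → fromℕ (r C l) * p l)

  -- Pascal's rule, in the form `(1 + z)^(r+1) = z (1 + z)^r + (1 + z)^r`.
  binomialSum-suc : ∀ r p →
    binomialSum (suc r) p ≈ binomialSum r (λ l → p (suc l)) + binomialSum r p
  binomialSum-suc r p = begin
    binomialSum (suc r) p
      ≈⟨ sumTo-suc (suc r) _ ⟩
    fromℕ (suc r C 0) * p 0 + sumTo (suc r) (λ l → fromℕ (suc r C suc l) * p (suc l))
      ≈⟨ +-cong
           (*-congʳ (reflexive (≡.cong fromℕ (≡.trans (nC0≡1 (suc r)) (≡.sym (nC0≡1 r))))))
           (trans (sumTo-cong (suc r) (λ l _ → pascal l)) (sumTo-+ (suc r) _ _)) ⟩
    fromℕ (r C 0) * p 0 + (binomialSum r (λ l → p (suc l)) + T)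
      ≈⟨ +-Semigroup.x∙yz≈y∙xz _ _ _ ⟩
    binomialSum r (λ l → p (suc l)) + (fromℕ (r C 0) * p 0 + T)
      -- `T` reaches `p (suc r)`, one term beyond `binomialSum r p`; the coefficient `r C suc r` of
      -- that term is zero.
      ≈⟨ +-congˡ (sumTo-suc (suc r) _) ⟨
    binomialSum r (λ l → p (suc l)) + (binomialSum r p + fromℕ (r C suc r) * p (suc r))
      ≈⟨ +-congˡ (trans (+-congˡ top≈0) (+-identityʳ _)) ⟩
    binomialSum r (λ l → p (suc l)) + binomialSum r p
      ∎
    where
    T = sumTo (suc r) (λ l → fromℕ (r C suc l) * p (suc l))
    pascal : ∀ l → fromℕ (suc r C suc l) * p (suc l) ≈
                   fromℕ (r C l) * p (suc l) + fromℕ (r C suc l) * p (suc l)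
    pascal l = trans
      (*-congʳ (trans (reflexive (≡.cong fromℕ (≡.sym (nCk+nC[k+1]≡[n+1]C[k+1] r l))))
                      (fromℕ-+ (r C l) (r C suc l))))
      (distribʳ _ _ _)
    top≈0 : fromℕ (r C suc r) * p (suc r) ≈ 0#
    top≈0 = trans (*-congʳ (reflexive (≡.cong fromℕ (k>n⇒nCk≡0 (ℕₚ.n<1+n r))))) (zeroˡ _)

  -- Powers of `e_q(t)` and of `e_q(t) + 1`.

  compSum-cong : ∀ l m {f g : Vec ℕ l → Carrier} → (∀ is → f is ≈ g is) →
    compSum l m f ≈ compSum l m g
  compSum-cong zero    zero    f≈g = f≈g []
  compSum-cong zero    (suc m) f≈g = refl
  compSum-cong (suc l) m       f≈g =
    sumTo-cong (suc m) λ i _ → compSum-cong l (m ∸ i) λ is → f≈g (i ∷ is)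

  *-compSum : ∀ a l m (f : Vec ℕ l → Carrier) →
    a * compSum l m f ≈ compSum l m (λ is → a * f is)
  *-compSum a zero    zero    f = refl
  *-compSum a zero    (suc m) f = zeroʳ a
  *-compSum a (suc l) m       f = trans (*-sumTo a (suc m) _)
    (sumTo-cong (suc m) λ i _ → *-compSum a l (m ∸ i) _)

  -- The coefficients of e_q(t)^l.
  eqPow : ℕ → PS
  eqPow l m = compSum l m prodFactInv

  eqPow-zero : eqPow 0 ≋ constPS 1#
  eqPow-zero zero    = refl
  eqPow-zero (suc m) = refl

  -- Fixing the first part `i` of a composition of `m` pulls out `qfactInv i` and leaves a
  -- composition of `m ∸ i` into `l` parts.
  eqPow-suc : ∀ l → eqPow (suc l) ≋ (eq ⋆ eqPow l)
  eqPow-suc l m = sumTo-cong (suc m) λ i _ → sym (*-compSum (qfactInv i) l (m ∸ i) _)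

  -- The coefficients of (e_q(t) + 1)^r, in binomially expanded form.
  eq+1Pow : ℕ → PS
  eq+1Pow r m = binomialSum r (λ l → eqPow l m)

  eq+1Pow-zero : eq+1Pow 0 ≋ constPS 1#
  eq+1Pow-zero m = begin
    0# + (1# + 0#) * eqPow 0 m  ≈⟨ +-identityˡ _ ⟩
    (1# + 0#) * eqPow 0 m       ≈⟨ *-congʳ (+-identityʳ 1#) ⟩
    1# * eqPow 0 m              ≈⟨ *-identityˡ _ ⟩
    eqPow 0 m                   ≈⟨ eqPow-zero m ⟩
    constPS 1# m                ∎

  -- In `binomialSum-suc` the shifted sum carries one more factor `eq`, and the unshifted sum is the
  -- product with the constant series `1`.
  eq+1Pow-suc : ∀ r → eq+1Pow (suc r) ≋ ((eq ⊕ constPS 1#) ⋆ eq+1Pow r)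
  eq+1Pow-suc r m = begin
    eq+1Pow (suc r) m
      ≈⟨ binomialSum-suc r _ ⟩
    binomialSum r (λ l → eqPow (suc l) m) + eq+1Pow r m
      ≈⟨ +-cong shift (sym (⋆-identityˡ (eq+1Pow r) m)) ⟩
    (eq ⋆ eq+1Pow r) m + (constPS 1# ⋆ eq+1Pow r) m
      ≈⟨ ⋆-distribʳ-⊕ eq (constPS 1#) (eq+1Pow r) m ⟨
    ((eq ⊕ constPS 1#) ⋆ eq+1Pow r) m
      ∎
    where
    shift : binomialSum r (λ l → eqPow (suc l) m) ≈ (eq ⋆ eq+1Pow r) m
    shift = begin
      sumTo (suc r) (λ l → fromℕ (r C l) * eqPow (suc l) m)
        ≈⟨ sumTo-cong (suc r) (λ l _ → trans (*-congˡ (eqPow-suc l m)) (*-sumTo _ (suc m) _)) ⟩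
      sumTo (suc r) (λ l → sumTo (suc m) (λ i → fromℕ (r C l) * (eq i * eqPow l (m ∸ i))))
        -- With the sum over `l` innermost, `eq i` factors out and what remains is
        -- `eq+1Pow r (m ∸ i)`.
        ≈⟨ sumTo-swap (suc r) (suc m) _ ⟩
      sumTo (suc m) (λ i → sumTo (suc r) (λ l → fromℕ (r C l) * (eq i * eqPow l (m ∸ i))))
        ≈⟨ sumTo-cong (suc m) (λ i _ → trans
             (sumTo-cong (suc r) λ l _ → *-Semigroup.x∙yz≈y∙xz _ _ _)
             (sym (*-sumTo (eq i) (suc r) _))) ⟩
      (eq ⋆ eq+1Pow r) m
        ∎

  -- Cancelling powers of `e_q(t) + 1` against powers of `2 / (e_q(t) + 1)`.

  module _ (2*i2≈1 : (1# + 1#) * i2 ≈ 1#) where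

    eq+1⋆twoOver : ((eq ⊕ constPS 1#) ⋆ twoOver) ≋ constPS (1# + 1#)
    eq+1⋆twoOver n = begin
      (D ⋆ twoOver) n
        ≈⟨ sumTo-cong (suc n) (λ k _ → *-Semigroup.x∙yz≈y∙xz _ _ _) ⟩
      sumTo (suc n) (λ k → (1# + 1#) * (D k * invPS D i2 (n ∸ k)))
        ≈⟨ *-sumTo _ (suc n) _ ⟨
      (1# + 1#) * (D ⋆ invPS D i2) n
        -- The constant term of `D` unfolds to `1# + 1#`, so `2*i2≈1` says that `i2` inverts it.
        ≈⟨ *-congˡ (⋆-invPS D i2 2*i2≈1 n) ⟩
      (1# + 1#) * constPS 1# n
        ≈⟨ scale n ⟩
      constPS (1# + 1#) n
        ∎
      where
      D = eq ⊕ constPS 1#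
      scale : ∀ n → (1# + 1#) * constPS 1# n ≈ constPS (1# + 1#) n
      scale zero    = *-identityʳ _
      scale (suc n) = zeroʳ _

    -- Each factor `e_q(t) + 1` is paired with one factor `twoOver`, and each pair contributes a
    -- constant `2`.
    eq+1Pow⋆twoOverPow : ∀ r →
      (eq+1Pow r ⋆ powPS twoOver r) ≋ constPS (pow (1# + 1#) r)
    eq+1Pow⋆twoOverPow zero    = ⋆.trans
      {eq+1Pow 0 ⋆ constPS 1#} {constPS 1# ⋆ constPS 1#} {constPS 1#}
      (⋆-cong {eq+1Pow 0} {_} {constPS 1#} eq+1Pow-zero (λ _ → refl))
      (⋆-identityˡ (constPS 1#))
    eq+1Pow⋆twoOverPow (suc r) = RS.begin
      (eq+1Pow (suc r) ⋆ (Gʳ ⋆ G))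
        RS.≈⟨ ⋆-cong {eq+1Pow (suc r)} {_} {Gʳ ⋆ G} (eq+1Pow-suc r) (⋆-comm Gʳ G) ⟩
      ((D ⋆ eq+1Pow r) ⋆ (G ⋆ Gʳ))
        RS.≈⟨ ⋆-Semigroup.interchange D (eq+1Pow r) G Gʳ ⟩
      ((D ⋆ G) ⋆ (eq+1Pow r ⋆ Gʳ))
        RS.≈⟨ ⋆-cong {D ⋆ G} {_} {eq+1Pow r ⋆ Gʳ} eq+1⋆twoOver (eq+1Pow⋆twoOverPow r) ⟩
      (constPS (1# + 1#) ⋆ constPS (pow (1# + 1#) r))
        RS.≈⟨ constPS-* ⟩
      constPS (pow (1# + 1#) (suc r))
        RS.∎
      where
      module RS = ⋆-Reasoning
      D = eq ⊕ constPS 1#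
      G = twoOver
      Gʳ = powPS twoOver r
      constPS-* : (constPS (1# + 1#) ⋆ constPS (pow (1# + 1#) r)) ≋
                  constPS (pow (1# + 1#) (suc r))
      constPS-* zero    = trans (constPS-⋆ _ (constPS _) 0) (*-comm _ _)
      constPS-* (suc n) = trans (constPS-⋆ _ (constPS _) (suc n)) (zeroʳ _)

    -- The left side is bracketed as the convolution over `k` yields it: the generating function of
    -- the order-`r` polynomials times that of the weights. Regrouping lets the two `r`-th powers
    -- meet.
    twoOver-expansion : ∀ r x n →
      ((powPS twoOver r ⋆ eqx x) ⋆ (eq+1Pow r ⋆ twoOver)) n ≈
      pow (1# + 1#) r * (twoOver ⋆ eqx x) n
    twoOver-expansion r x n = begin
      ((Gʳ ⋆ eqx x) ⋆ (L ⋆ G)) n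
        ≈⟨ ⋆-Semigroup.interchange Gʳ (eqx x) L G n ⟩
      ((Gʳ ⋆ L) ⋆ (eqx x ⋆ G)) n
        ≈⟨ ⋆-cong {Gʳ ⋆ L} {L ⋆ Gʳ} {eqx x ⋆ G} (⋆-comm Gʳ L) (⋆-comm (eqx x) G) n ⟩
      ((L ⋆ Gʳ) ⋆ (G ⋆ eqx x)) n
        ≈⟨ ⋆-cong {L ⋆ Gʳ} {_} {G ⋆ eqx x} (eq+1Pow⋆twoOverPow r) (λ _ → refl) n ⟩
      (constPS (pow (1# + 1#) r) ⋆ (G ⋆ eqx x)) n
        ≈⟨ constPS-⋆ _ (G ⋆ eqx x) n ⟩
      pow (1# + 1#) r * (G ⋆ eqx x) n
        ∎
      where
      G = twoOver
      Gʳ = powPS twoOver r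
      L = eq+1Pow r

  -- Comparing coefficients: `q`-factorials and the sums in the identity.

  eqx-0 : eqx 0# ≋ constPS 1#
  eqx-0 zero    = *-identityˡ 1#
  eqx-0 (suc n) = trans (*-congʳ (zeroʳ _)) (zeroˡ _)

  -- Since `e_q(0 t) = 1`, this turns `Eq0 d` into `qfact d * twoOver d`.
  ⋆-eqx-0 : ∀ a → (a ⋆ eqx 0#) ≋ a
  ⋆-eqx-0 a n = begin
    (a ⋆ eqx 0#) n
      ≈⟨ ⋆-comm a (eqx 0#) n ⟩
    (eqx 0# ⋆ a) n
      ≈⟨ ⋆-cong {eqx 0#} {_} {a} eqx-0 (λ _ → refl) n ⟩
    (constPS 1# ⋆ a) n
      ≈⟨ ⋆-identityˡ a n ⟩
    a n
      ∎

  module _ (qint*iq≈1 : ∀ n → qint (suc n) * iq n ≈ 1#) where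

    qfact*qfactInv≈1 : ∀ n → qfact n * qfactInv n ≈ 1#
    qfact*qfactInv≈1 zero    = *-identityˡ 1#
    qfact*qfactInv≈1 (suc n) = begin
      (qfact n * qint (suc n)) * (qfactInv n * iq n)
        ≈⟨ *-Semigroup.interchange _ _ _ _ ⟩
      (qfact n * qfactInv n) * (qint (suc n) * iq n)
        ≈⟨ *-cong (qfact*qfactInv≈1 n) (qint*iq≈1 n) ⟩
      1# * 1#
        ≈⟨ *-identityˡ 1# ⟩
      1#
        ∎

    -- All q-factorials except [n]! and 1/[k]! cancel in pairs.
    summand : ∀ n k m a {l} (is : Vec ℕ l) →
      a * qmultinom m is * qbinom (m ℕ.+ k) m * qbinom n (m ℕ.+ k) * Eq0 (n ∸ m ∸ k) ≈
      (qfact n * qfactInv k * twoOver (n ∸ k ∸ m) * a) * prodFactInv is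
    summand n k m a is
      -- Both `n ∸ m ∸ k` and `n ∸ k ∸ m` become `n ∸ (m + k)`, so the factorial in `Eq0` meets its
      -- inverse from `qbinom n (m + k)`.
      rewrite ℕₚ.m+n∸m≡n m k | ℕₚ.∸-+-assoc n m k | ℕₚ.∸-+-assoc n k m | ℕₚ.+-comm k m = begin
      a * (qfact m * P) * (qfact mk * (qfactInv m * qfactInv k))
        * (qfact n * (qfactInv mk * qfactInv d)) * (qfact d * (twoOver ⋆ eqx 0#) d)
        ≈⟨ *-congˡ (*-congˡ (⋆-eqx-0 twoOver d)) ⟩
      a * (qfact m * P) * (qfact mk * (qfactInv m * qfactInv k))
        * (qfact n * (qfactInv mk * qfactInv d)) * (qfact d * twoOver d)
        ≈⟨ solve 11 (λ a M P M+K Mi Ki N M+Ki Di D G →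
             ((((a ⊗ (M ⊗ P)) ⊗ (M+K ⊗ (Mi ⊗ Ki))) ⊗ (N ⊗ (M+Ki ⊗ Di))) ⊗ (D ⊗ G)) ⊜
             ((((M ⊗ Mi) ⊗ (M+K ⊗ M+Ki)) ⊗ (D ⊗ Di)) ⊗ ((((N ⊗ Ki) ⊗ G) ⊗ a) ⊗ P)))
             refl a (qfact m) P (qfact mk) (qfactInv m) (qfactInv k) (qfact n)
             (qfactInv mk) (qfactInv d) (qfact d) (twoOver d) ⟩
      (qfact m * qfactInv m) * (qfact mk * qfactInv mk) * (qfact d * qfactInv d) * S
        ≈⟨ *-congʳ (*-cong (*-cong (qfact*qfactInv≈1 m) (qfact*qfactInv≈1 mk))
                           (qfact*qfactInv≈1 d)) ⟩
      1# * 1# * 1# * S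
        ≈⟨ *-congʳ (trans (*-congʳ (*-identityˡ 1#)) (*-identityˡ 1#)) ⟩
      1# * S
        ≈⟨ *-identityˡ S ⟩
      S
        ∎
      where
      open Algebra.Solver.CommutativeMonoid *-commutativeMonoid
        using (solve; _⊜_) renaming (_⊕_ to _⊗_)
      mk = m ℕ.+ k
      d = n ∸ mk
      P = prodFactInv is
      S = qfact n * qfactInv k * twoOver d * a * P

    -- After `summand` the sums collapse from the inside out: compositions give `eqPow l m`, the sum
    -- over `l` gives `eq+1Pow r m`, and the sum over `m` is a Cauchy product with `twoOver`.
    coefficient : ∀ n r k →
      sumTo (suc (n ∸ k)) (λ m →
        sumTo (suc r) (λ l →
          compSum l m (λ is →
            fromℕ (r C l) * qmultinom m is * qbinom (m ℕ.+ k) m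
              * qbinom n (m ℕ.+ k) * Eq0 (n ∸ m ∸ k)))) ≈
      qfact n * qfactInv k * (eq+1Pow r ⋆ twoOver) (n ∸ k)
    coefficient n r k = trans
      (sumTo-cong (suc (n ∸ k)) λ m _ → inner m)
      (sym (*-sumTo _ (suc (n ∸ k)) _))
      where
      A = qfact n * qfactInv k
      inner : ∀ m →
        sumTo (suc r) (λ l →
          compSum l m (λ is →
            fromℕ (r C l) * qmultinom m is * qbinom (m ℕ.+ k) m
              * qbinom n (m ℕ.+ k) * Eq0 (n ∸ m ∸ k))) ≈
        A * (eq+1Pow r m * twoOver (n ∸ k ∸ m))
      inner m = begin
        _
          ≈⟨ sumTo-cong (suc r) (λ l _ → trans
               (compSum-cong l m (summand n k m (fromℕ (r C l))))
               (trans (sym (*-compSum _ l m prodFactInv)) (*-assoc _ _ _))) ⟩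
        sumTo (suc r) (λ l → A * g * (fromℕ (r C l) * eqPow l m))
          ≈⟨ *-sumTo (A * g) (suc r) _ ⟨
        A * g * eq+1Pow r m
          ≈⟨ *-Semigroup.xy∙z≈x∙zy _ _ _ ⟩
        A * (eq+1Pow r m * g)
          ∎
        where g = twoOver (n ∸ k ∸ m)

    -- The factor `qfactInv k` left by `coefficient` cancels the `qfact k` in `Eqr r k x`, so the
    -- sum over `k` is again a Cauchy product.
    rhs8-twoOver : ∀ n r x →
      rhs8 n r x ≈
      pow i2 r * (qfact n * ((powPS twoOver r ⋆ eqx x) ⋆ (eq+1Pow r ⋆ twoOver)) n)
    rhs8-twoOver n r x = *-congˡ (trans
      (sumTo-cong (suc n) λ k _ → trans (*-congʳ (coefficient n r k)) (cancel k))
      (sym (*-sumTo (qfact n) (suc n) _)))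
      where
      J = powPS twoOver r ⋆ eqx x
      H = eq+1Pow r ⋆ twoOver
      cancel : ∀ k →
        qfact n * qfactInv k * H (n ∸ k) * (qfact k * J k) ≈ qfact n * (J k * H (n ∸ k))
      cancel k = begin
        qfact n * qfactInv k * H (n ∸ k) * (qfact k * J k)
          ≈⟨ *-Semigroup.interchange _ _ _ _ ⟩
        qfact n * qfactInv k * qfact k * (H (n ∸ k) * J k)
          ≈⟨ *-cong (*-assoc _ _ _) (*-comm _ _) ⟩
        qfact n * (qfactInv k * qfact k) * (J k * H (n ∸ k))
          ≈⟨ *-congʳ (*-congˡ (trans (*-comm _ _) (qfact*qfactInv≈1 k))) ⟩
        qfact n * 1# * (J k * H (n ∸ k))
          ≈⟨ *-congʳ (*-identityʳ _) ⟩
        qfact n * (J k * H (n ∸ k))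
          ∎

theorem8 : {c ℓ : Level} (R : CommutativeRing c ℓ) →
    let open CommutativeRing R in
    (q i1q i2 : Carrier) (iq : ℕ → Carrier) →
    (1# - q) * i1q ≈ 1# →
    (1# + 1#) * i2 ≈ 1# →
    (∀ n → QEuler.qint R q i1q i2 iq (suc n) * iq n ≈ 1#) →
    (n r : ℕ) (x : Carrier) →
    QEuler.Eq R q i1q i2 iq n x ≈ QEuler.rhs8 R q i1q i2 iq n r x
theorem8 R q i1q i2 iq _ 2*i2≈1 qint*iq≈1 n r x = sym (begin
  rhs8 n r x
    ≈⟨ rhs8-twoOver qint*iq≈1 n r x ⟩
  pow i2 r * (qfact n * ((powPS twoOver r ⋆ eqx x) ⋆ (eq+1Pow r ⋆ twoOver)) n)
    -- Moving the power of `2` past `qfact n` leaves exactly the definition of `Eq n x`, and brings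
    -- that power next to `pow i2 r`.
    ≈⟨ *-congˡ (trans (*-congˡ (twoOver-expansion 2*i2≈1 r x n)) (x∙yz≈y∙xz _ _ _)) ⟩
  pow i2 r * (pow (1# + 1#) r * Eq n x)
    ≈⟨ *-assoc _ _ _ ⟨
  pow i2 r * pow (1# + 1#) r * Eq n x
    ≈⟨ *-congʳ (pow-* i2 (1# + 1#) (trans (*-comm _ _) 2*i2≈1) r) ⟩
  1# * Eq n x
    ≈⟨ *-identityˡ _ ⟩
  Eq n x
    ∎)
  where
  open CommutativeRing R
  open QEuler R q i1q i2 iq
  open PowerSeries R q i1q i2 iq
  open Algebra.Properties.CommutativeSemigroup *-commutativeSemigroup using (x∙yz≈y∙xz)
  open Relation.Binary.Reasoning.Setoid setoid
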